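{- Let $A^{\Box}$ be any formula of the bimodal language (with modalities $\Box$ and $\blacksquare$) that contains no occurrence of the modality $\blacksquare$. Then $A^{\Box}$ is provable in $\mathsf{GR}$ if and only if $A^{\Box}$ is provable in $\mathsf{GL}$. Here $\mathsf{GR}$ is the hypersequent calculus and $\mathsf{GL}$ the axiomatic system specified in the context, and a formula $A$ is called provable in $\mathsf{GR}$ if the one-component hypersequent $\to A$ is provable in $\mathsf{GR}$.
   Context: **Formulas.** $A ::= p \mid \bot \mid \neg A \mid A\wedge A \mid \blacksquare A \mid \Box A$, where $p$ ranges over propositional variables. Other connectives are abbreviations defined from $\wedge,\neg$ (e.g. $A\vee B:=\neg(\neg A\wedge\neg B)$, $A\supset B:=\neg(A\wedge\neg B)$), and $\Diamond A:=\neg\Box\neg A$. **The system $\mathsf{GL}$** (Gödel–Löb provability logic), in the language without $\blacksquare$. Axioms: axioms of classical propositional logic; $\Box(A\supset B)\supset(\Box A\supset\Box B)$; $\Box(\Box A\supset A)\supset\Box A$. Rules: from $A$ and $A\supset B$ infer $B$; from $A$ infer $\Box A$. **Sequents and hypersequents.** $\Gamma,\Delta,\Pi,\Theta$ denote finite (possibly empty) multisets of formulas. There are two sorts of sequents: $\to$-sequents $\Gamma\to\Delta$ and $\Rightarrow$-sequents $\Gamma\Rightarrow\Delta$. A hypersequent is a finite expression $S_1\mid S_2\mid\cdots\mid S_n$ of sequents of either sort, identified with all its permutations (i.e. a finite multiset of sequents). In the rules below, the side hypersequents ${\cal H},{\cal I}$ are arbitrary and possibly empty. The symbol $\gg$ stands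 for either $\to$ or $\Rightarrow$, uniformly the same throughout one instance of a rule. We write "premise(s) $/$ conclusion". **The hypersequent calculus $\mathsf{GR}$.** A proof is a finite tree built from initial sequents by the rules. Initial sequents: $A\to A$ (for every formula $A$) and $\bot\to$. Propositional rules: - $(\wedge{:}l)$ ${\cal H}\mid A,\Gamma\gg\Delta \;/\; {\cal H}\mid A\wedge B,\Gamma\gg\Delta$; and ${\cal H}\mid B,\Gamma\gg\Delta \;/\; {\cal H}\mid A\wedge B,\Gamma\gg\Delta$. - $(\wedge{:}r)$ ${\cal H}\mid\Gamma\gg\Delta,A$ and ${\cal I}\mid\Pi\gg\Theta,B \;/\; {\cal H}\mid{\cal I}\mid\Gamma,\Pi\gg\Delta,\Theta,A\wedge B$. - $(\neg{:}l)$ ${\cal H}\mid\Gamma\gg\Delta,A \;/\; {\cal H}\mid\neg A,\Gamma\gg\Delta$. - $(\neg{:}r)$ ${\cal H}\mid A,\Gamma\gg\Delta \;/\; {\cal H}\mid\Gamma\gg\Delta,\neg A$. Internal structural rules: - $(ic)$ ${\cal H}\mid A,A,\Gamma\gg\Delta \;/\; {\cal H}\mid A,\Gamma\gg\Delta$; and ${\cal H}\mid\Gamma\gg\Delta,A,A \;/\; {\cal H}\mid\Gamma\gg\Delta,A$. - $(iw)$ ${\cal H}\mid\Gamma\gg\Delta \;/\; {\cal H}\mid A,\Gamma\gg\Delta$; and ${\cal H}\mid\Gamma\gg\Delta \;/\; {\cal H}\mid\Gamma\gg\Delta,A$. - $(cut)$ ${\cal H}\mid\Gamma\gg\Delta,A$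 and ${\cal I}\mid A,\Pi\gg\Theta \;/\; {\cal H}\mid{\cal I}\mid\Gamma,\Pi\gg\Delta,\Theta$. External structural rules: - $(ew)$ ${\cal H} \;/\; {\cal H}\mid S$, for any sequent $S$ of either sort (here the premise ${\cal H}$ is a hypersequent, hence nonempty). - $(split)$ ${\cal H}\mid\Gamma,\Theta\to\Delta,\Pi \;/\; {\cal H}\mid\Gamma\to\Delta\mid\Theta\to\Pi$. - $(merge)$ ${\cal H}\mid\Gamma\gg\Delta\mid\Theta\gg\Pi \;/\; {\cal H}\mid\Gamma,\Theta\gg\Delta,\Pi$. - $(\bot)$ ${\cal H}\mid\Gamma\Rightarrow\Delta\mid\ \to\ \;/\; {\cal H}\mid\Gamma\Rightarrow\Delta$ (here "$\to$" is the empty $\to$-sequent). Modal rules: - $(K)$ ${\cal H}\mid A,\Gamma\Rightarrow\Delta \;/\; {\cal H}\mid\Box A\to\ \mid\Gamma\Rightarrow\Delta$. - $(4)$ ${\cal H}\mid\Box A,\Gamma\Rightarrow\Delta \;/\; {\cal H}\mid\Box A\to\ \mid\Gamma\Rightarrow\Delta$. - $(\Box{:}r)$ ${\cal H}\mid\Box A\Rightarrow A \;/\; {\cal H}\mid\ \to\Box A$. - $(K^\blacksquare)$ ${\cal H}\mid A,\Gamma\Rightarrow\Delta \;/\; {\cal H}\mid\blacksquare A\to\ \mid\Gamma\Rightarrow\Delta$. - $(4^\blacksquare)$ ${\cal H}\mid\blacksquare A,\Gamma\Rightarrow\Delta \;/\; {\cal H}\mid\blacksquare A\to\ \mid\Gamma\Rightarrow\Delta$.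 - $(\blacksquare{:}r_1)$ ${\cal H}\mid\Box A\Rightarrow A \;/\; {\cal H}\mid\ \to\blacksquare A\mid\ \Rightarrow\ $ (the last component is the empty $\Rightarrow$-sequent). - $(\blacksquare{:}l)$ ${\cal H}\mid A\Rightarrow\ \;/\; {\cal H}\mid\blacksquare A\Rightarrow\ $. - $(\blacksquare{:}r_2)$ ${\cal H}\mid\ \Rightarrow A \;/\; {\cal H}\mid\ \Rightarrow\blacksquare A$. Modal structural rules (premise and conclusion consist of a single sequent, with no side hypersequent): - $(\Rightarrow)$ $\Gamma\to\Delta \;/\; \Gamma\Rightarrow\Delta$. - $(\to)$ $\Gamma\Rightarrow\Delta \;/\; \Gamma\to\Delta$. -}

module Defs where

open import Data.List.Base using (List; []; _∷_; _++_; [_])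
open import Data.List.Relation.Binary.Permutation.Homogeneous using (Permutation)
open import Data.List.Relation.Binary.Permutation.Propositional using (_↭_)
open import Data.Nat.Base using (ℕ)

infix  9 ¬ᶠ_ ■_ □_
infixr 8 _∧ᶠ_
infixr 7 _⊃_

data Formula : Set where
  var  : ℕ → Formula
  ⊥ᶠ   : Formula
  ¬ᶠ_  : Formula → Formula
  _∧ᶠ_ : Formula → Formula → Formula
  ■_   : Formula → Formula
  □_   : Formula → Formula

_⊃_ : Formula → Formula → Formula
A ⊃ B = ¬ᶠ (A ∧ᶠ ¬ᶠ B)

data ■-Free : Formula → Set where
  var  : ∀ p → ■-Free (var p)
  ⊥ᶠ   : ■-Free ⊥ᶠ
  ¬ᶠ_  : ∀ {A} → ■-Free A → ■-Free (¬ᶠ A)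
  _∧ᶠ_ : ∀ {A B} → ■-Free A → ■-Free B → ■-Free (A ∧ᶠ B)
  □_   : ∀ {A} → ■-Free A → ■-Free (□ A)

-- The first seven schemes, with modus ponens, are a complete axiomatization of
-- classical propositional logic: Łukasiewicz's axioms for ⊃ and ¬, the usual
-- axioms for ∧, and ex falso for ⊥.
data GLAxiom : Formula → Set where
  ax-weak   : ∀ A B   → GLAxiom (A ⊃ B ⊃ A)
  ax-dist   : ∀ A B C → GLAxiom ((A ⊃ B ⊃ C) ⊃ (A ⊃ B) ⊃ A ⊃ C)
  ax-contra : ∀ A B   → GLAxiom ((¬ᶠ A ⊃ ¬ᶠ B) ⊃ B ⊃ A)
  ax-∧-elˡ  : ∀ A B   → GLAxiom (A ∧ᶠ B ⊃ A)
  ax-∧-elʳ  : ∀ A B   → GLAxiom (A ∧ᶠ B ⊃ B)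
  ax-∧-in   : ∀ A B   → GLAxiom (A ⊃ B ⊃ A ∧ᶠ B)
  ax-⊥      : ∀ A     → GLAxiom (⊥ᶠ ⊃ A)
  ax-K      : ∀ A B   → GLAxiom (□ (A ⊃ B) ⊃ □ A ⊃ □ B)
  ax-Löb    : ∀ A     → GLAxiom (□ (□ A ⊃ A) ⊃ □ A)

-- GL lives in the language without ■. Restricting the axioms to that language
-- suffices, since both rules preserve ■-freeness.
infix 2 GL⊢_
data GL⊢_ : Formula → Set where
  axiom : ∀ {A} → GLAxiom A → ■-Free A → GL⊢ A
  mp    : ∀ {A B} → GL⊢ A → GL⊢ A ⊃ B → GL⊢ B
  nec   : ∀ {A} → GL⊢ A → GL⊢ □ A

data Arrow : Set where
  single double : Arrow

infix 4 _⟨_⟩_ _⟶_ _⟹_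
record Sequent : Set where
  constructor _⟨_⟩_
  field
    antecedent : List Formula
    arrow      : Arrow
    succedent  : List Formula

pattern _⟶_ Γ Δ = Γ ⟨ single ⟩ Δ
pattern _⟹_ Γ Δ = Γ ⟨ double ⟩ Δ

-- Multisets are lists taken up to permutation: _≈ˢ_ is equality of sequents and
-- _≈ᴴ_ equality of hypersequents (multisets of sequents) in this reading.
infix 3 _≈ˢ_
data _≈ˢ_ : Sequent → Sequent → Set where
  seq≈ : ∀ {Γ Γ′ Δ Δ′} ≫ → Γ ↭ Γ′ → Δ ↭ Δ′ → Γ ⟨ ≫ ⟩ Δ ≈ˢ Γ′ ⟨ ≫ ⟩ Δ′

Hypersequent : Set
Hypersequent = List Sequent

infix 2 _≈ᴴ_
_≈ᴴ_ : Hypersequent → Hypersequent → Set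
_≈ᴴ_ = Permutation _≈ˢ_

infixr 3 _∣_
pattern _∣_ S H = S ∷ H

private
  variable
    A B     : Formula
    Γ Δ Π Θ : List Formula
    ≫       : Arrow
    S       : Sequent
    H I     : Hypersequent

-- The constructor `exch` implements the identification of hypersequents up to
-- _≈ᴴ_; all other constructors put the active components and formulas first.
-- `Hypersequent` includes the empty list so that side hypersequents may be
-- empty, but no rule derives []: in particular the premise of `ew` is nonempty.
infix 2 GR⊢ʰ_
data GR⊢ʰ_ : Hypersequent → Set where
  exch  : H ≈ᴴ I → GR⊢ʰ H → GR⊢ʰ I

  init  : ∀ A → GR⊢ʰ [ [ A ] ⟶ [ A ] ]
  init⊥ : GR⊢ʰ [ [ ⊥ᶠ ] ⟶ [] ]

  ∧l₁   : GR⊢ʰ A ∷ Γ ⟨ ≫ ⟩ Δ ∣ H → GR⊢ʰ A ∧ᶠ B ∷ Γ ⟨ ≫ ⟩ Δ ∣ H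
  ∧l₂   : GR⊢ʰ B ∷ Γ ⟨ ≫ ⟩ Δ ∣ H → GR⊢ʰ A ∧ᶠ B ∷ Γ ⟨ ≫ ⟩ Δ ∣ H
  ∧r    : GR⊢ʰ Γ ⟨ ≫ ⟩ A ∷ Δ ∣ H → GR⊢ʰ Π ⟨ ≫ ⟩ B ∷ Θ ∣ I →
          GR⊢ʰ Γ ++ Π ⟨ ≫ ⟩ A ∧ᶠ B ∷ Δ ++ Θ ∣ H ++ I
  ¬l    : GR⊢ʰ Γ ⟨ ≫ ⟩ A ∷ Δ ∣ H → GR⊢ʰ ¬ᶠ A ∷ Γ ⟨ ≫ ⟩ Δ ∣ H
  ¬r    : GR⊢ʰ A ∷ Γ ⟨ ≫ ⟩ Δ ∣ H → GR⊢ʰ Γ ⟨ ≫ ⟩ ¬ᶠ A ∷ Δ ∣ H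

  icl   : GR⊢ʰ A ∷ A ∷ Γ ⟨ ≫ ⟩ Δ ∣ H → GR⊢ʰ A ∷ Γ ⟨ ≫ ⟩ Δ ∣ H
  icr   : GR⊢ʰ Γ ⟨ ≫ ⟩ A ∷ A ∷ Δ ∣ H → GR⊢ʰ Γ ⟨ ≫ ⟩ A ∷ Δ ∣ H
  iwl   : GR⊢ʰ Γ ⟨ ≫ ⟩ Δ ∣ H → GR⊢ʰ A ∷ Γ ⟨ ≫ ⟩ Δ ∣ H
  iwr   : GR⊢ʰ Γ ⟨ ≫ ⟩ Δ ∣ H → GR⊢ʰ Γ ⟨ ≫ ⟩ A ∷ Δ ∣ H
  cut   : GR⊢ʰ Γ ⟨ ≫ ⟩ A ∷ Δ ∣ H → GR⊢ʰ A ∷ Π ⟨ ≫ ⟩ Θ ∣ I →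
          GR⊢ʰ Γ ++ Π ⟨ ≫ ⟩ Δ ++ Θ ∣ H ++ I

  ew    : GR⊢ʰ H → GR⊢ʰ S ∣ H
  split : GR⊢ʰ Γ ++ Θ ⟶ Δ ++ Π ∣ H → GR⊢ʰ Γ ⟶ Δ ∣ Θ ⟶ Π ∣ H
  merge : GR⊢ʰ Γ ⟨ ≫ ⟩ Δ ∣ Θ ⟨ ≫ ⟩ Π ∣ H → GR⊢ʰ Γ ++ Θ ⟨ ≫ ⟩ Δ ++ Π ∣ H
  drop⟶ : GR⊢ʰ Γ ⟹ Δ ∣ [] ⟶ [] ∣ H → GR⊢ʰ Γ ⟹ Δ ∣ H

  K□    : GR⊢ʰ A ∷ Γ ⟹ Δ ∣ H → GR⊢ʰ [ □ A ] ⟶ [] ∣ Γ ⟹ Δ ∣ H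
  4□    : GR⊢ʰ □ A ∷ Γ ⟹ Δ ∣ H → GR⊢ʰ [ □ A ] ⟶ [] ∣ Γ ⟹ Δ ∣ H
  □r    : GR⊢ʰ [ □ A ] ⟹ [ A ] ∣ H → GR⊢ʰ [] ⟶ [ □ A ] ∣ H
  K■    : GR⊢ʰ A ∷ Γ ⟹ Δ ∣ H → GR⊢ʰ [ ■ A ] ⟶ [] ∣ Γ ⟹ Δ ∣ H
  4■    : GR⊢ʰ ■ A ∷ Γ ⟹ Δ ∣ H → GR⊢ʰ [ ■ A ] ⟶ [] ∣ Γ ⟹ Δ ∣ H
  ■r₁   : GR⊢ʰ [ □ A ] ⟹ [ A ] ∣ H → GR⊢ʰ [] ⟶ [ ■ A ] ∣ [] ⟹ [] ∣ H
  ■l    : GR⊢ʰ [ A ] ⟹ [] ∣ H → GR⊢ʰ [ ■ A ] ⟹ [] ∣ H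
  ■r₂   : GR⊢ʰ [] ⟹ [ A ] ∣ H → GR⊢ʰ [] ⟹ [ ■ A ] ∣ H

  to⟹  : GR⊢ʰ [ Γ ⟶ Δ ] → GR⊢ʰ [ Γ ⟹ Δ ]
  to⟶  : GR⊢ʰ [ Γ ⟹ Δ ] → GR⊢ʰ [ Γ ⟶ Δ ]

infix 2 GR⊢_
GR⊢_ : Formula → Set
GR⊢ A = GR⊢ʰ [ [] ⟶ [ A ] ]

{-# OPTIONS --safe #-}

-- From GL to GR: the axioms are derivable, modus ponens is a cut, and
-- necessitation is (⇒) followed by (□:r).
--
-- From GR to GL: read ■ A as (□ A ∧ ¬ □ ⊥) ∨ (□ ⊥ ∧ A), that is, as □ A at
-- non-terminal worlds and as A at terminal ones. Read Γ → Δ as ⋀ Γ ⊃ ⋁ Δ, read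
-- Γ ⇒ Δ as □ (⋀ Γ ⊃ ⋁ Δ), and a hypersequent as the disjunction of its
-- components. Every rule of GR, cut included, then preserves provability in GL.
-- The rule (→) amounts to the admissibility in GL of "from □ A infer A". This
-- follows from a truth valuation in which □ B is true when GL proves B: every
-- theorem is true, hence so is □ A when it is a theorem.
module Submission where

open import Defs
open import Data.Bool.Base using (Bool; true; false; not; T) renaming (_∧_ to _&&_)
open import Data.Bool.Properties using (T-∧)
open import Data.Fin.Base using (Fin; zero; suc)
open import Data.List.Base using (List; []; _∷_; _++_; [_]; map)
open import Data.List.Membership.Propositional using (_∈_)
open import Data.List.Membership.Propositional.Properties using (∈-∃++; ∈-++⁺ʳ)
open import Data.List.Properties using (map-++)
open import Data.List.Relation.Binary.Permutation.Homogeneous using (refl; prep; swap; trans)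
open import Data.List.Relation.Binary.Permutation.Propositional
  using (_↭_; refl; prep; swap; trans; ↭-sym)
open import Data.List.Relation.Binary.Permutation.Propositional.Properties
  using (shift; ++-comm) renaming (map⁺ to ↭-map⁺)
open import Data.List.Relation.Binary.Pointwise.Base using (Pointwise; []; _∷_)
import Data.List.Relation.Binary.Pointwise.Properties as Pointwise
open import Data.List.Relation.Unary.Any using (here; there)
open import Data.Nat.Base using (ℕ; zero; suc)
open import Data.Product.Base using (_×_; _,_; proj₁; proj₂)
open import Data.Vec.Base as Vec using (Vec; []; _∷_; lookup; allFin)
open import Data.Vec.N-ary using (N-ary; _$ⁿ_; ∀ⁿ; curryⁿ)
open import Function.Base using (_∘_; id)
open import Function.Bundles using (_⇔_; mk⇔; Equivalence)
open import Relation.Binary.PropositionalEquality using (_≡_; refl; cong; cong₂; subst; sym)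

private
  variable
    A B C X P Q R : Formula
    Γ Δ Π Θ       : List Formula
    n             : ℕ

-- Denecessitation in GL

-- Negation is relativised to the goal GL⊢ A (as in Friedman's translation), so
-- that the valuation argument needs no decision procedure for GL.
module _ (Goal : Set) where

  True : Formula → Set
  True (var p)  = Goal
  True ⊥ᶠ       = Goal
  True (¬ᶠ A)   = True A → Goal
  True (A ∧ᶠ B) = True A × True B
  True (■ A)    = Goal
  True (□ A)    = GL⊢ A

  axiom-true : ∀ {A} → GLAxiom A → ■-Free A → True A
  axiom-true (ax-weak A B)   _ (a , k) = k λ (_ , k′) → k′ a
  axiom-true (ax-dist A B C) _ (f , k) =
    k λ (g , k′) → k′ λ (a , k″) → g (a , λ b → f (a , λ h → h (b , k″)))
  axiom-true (ax-contra A B) _ (f , k) = k λ (b , ¬a) → f (¬a , λ ¬b → ¬b b)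
  axiom-true (ax-∧-elˡ A B)  _ ((a , _) , k) = k a
  axiom-true (ax-∧-elʳ A B)  _ ((_ , b) , k) = k b
  axiom-true (ax-∧-in A B)   _ (a , k) = k λ (b , k′) → k′ (a , b)
  axiom-true (ax-⊥ A)        _ (r , _) = r
  axiom-true (ax-K A B)      _ (f , k) = k λ (a , k′) → k′ (mp a f)
  -- Here `f` proves `□ A ⊃ A` in GL. The Löb axiom turns its necessitation into a proof of `□ A`,
  -- and `f` then yields `A`.
  axiom-true (ax-Löb A) free (f , k) = k (mp (mp (nec f) (axiom (ax-Löb A) free)) f)

  -- Truth of `A ⊃ B` unfolds to a statement ending in `Goal`, so modus ponens preserves truth only
  -- up to double negation relative to `Goal`.
  theorem-true : GL⊢ A → (True A → Goal) → Goal
  theorem-true (axiom a free) k = k (axiom-true a free)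
  theorem-true (mp d e)       k =
    theorem-true e λ f → theorem-true d λ a → f (a , k)
  theorem-true (nec d)        k = k d

-- With `Goal` taken to be `GL⊢ A`, which is also `True (□ A)`, the final continuation is the
-- identity.
denecessitation : GL⊢ □ A → GL⊢ A
denecessitation d = theorem-true _ d id

-- Interpretation of ■ in GL

infixr 7.5 _∨_
_∨_ : Formula → Formula → Formula
A ∨ B = ¬ᶠ (¬ᶠ A ∧ᶠ ¬ᶠ B)

⟪■⟫ : Formula → Formula
⟪■⟫ A = (□ A ∧ᶠ ¬ᶠ □ ⊥ᶠ) ∨ (□ ⊥ᶠ ∧ᶠ A)

τ : Formula → Formula
τ (var p)  = var p
τ ⊥ᶠ       = ⊥ᶠ
τ (¬ᶠ A)   = ¬ᶠ τ A
τ (A ∧ᶠ B) = τ A ∧ᶠ τ B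
τ (■ A)    = ⟪■⟫ (τ A)
τ (□ A)    = □ τ A

τ-free : ∀ A → ■-Free (τ A)
τ-free (var p)  = var p
τ-free ⊥ᶠ       = ⊥ᶠ
τ-free (¬ᶠ A)   = ¬ᶠ τ-free A
τ-free (A ∧ᶠ B) = τ-free A ∧ᶠ τ-free B
τ-free (■ A)    = ¬ᶠ (¬ᶠ ((□ τ-free A) ∧ᶠ (¬ᶠ (□ ⊥ᶠ))) ∧ᶠ ¬ᶠ ((□ ⊥ᶠ) ∧ᶠ τ-free A))
τ-free (□ A)    = □ τ-free A

τ-id : ■-Free A → τ A ≡ A
τ-id (var p)  = refl
τ-id ⊥ᶠ       = refl
τ-id (¬ᶠ a)   = cong ¬ᶠ_ (τ-id a)
τ-id (a ∧ᶠ b) = cong₂ _∧ᶠ_ (τ-id a) (τ-id b)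
τ-id (□ a)    = cong □_ (τ-id a)

-- Wrapping `GL⊢ τ A` in a record keeps `A` visible to unification, which could not recover it from
-- `τ A`.
infix 2 ⊢_
record ⊢_ (A : Formula) : Set where
  constructor interpreted
  field
    proof : GL⊢ τ A

open ⊢_

infixl 4 _·_
_·_ : ⊢ A ⊃ B → ⊢ A → ⊢ B
interpreted f · interpreted a = interpreted (mp a f)

necessitate : ⊢ A → ⊢ □ A
necessitate (interpreted a) = interpreted (nec a)

denecessitate : ⊢ □ A → ⊢ A
denecessitate (interpreted a) = interpreted (denecessitation a)

-- As `τ` commutes by definition with every connective but `■`, it sends each axiom instance to an
-- instance of the same scheme.
weakᴬ : ∀ A B → ⊢ A ⊃ B ⊃ A
weakᴬ A B = interpreted (axiom (ax-weak _ _) (τ-free (A ⊃ B ⊃ A)))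

distᴬ : ∀ A B C → ⊢ (A ⊃ B ⊃ C) ⊃ (A ⊃ B) ⊃ A ⊃ C
distᴬ A B C = interpreted (axiom (ax-dist _ _ _) (τ-free ((A ⊃ B ⊃ C) ⊃ (A ⊃ B) ⊃ A ⊃ C)))

contraᴬ : ∀ A B → ⊢ (¬ᶠ A ⊃ ¬ᶠ B) ⊃ B ⊃ A
contraᴬ A B = interpreted (axiom (ax-contra _ _) (τ-free ((¬ᶠ A ⊃ ¬ᶠ B) ⊃ B ⊃ A)))

∧-elˡᴬ : ∀ A B → ⊢ A ∧ᶠ B ⊃ A
∧-elˡᴬ A B = interpreted (axiom (ax-∧-elˡ _ _) (τ-free (A ∧ᶠ B ⊃ A)))

∧-elʳᴬ : ∀ A B → ⊢ A ∧ᶠ B ⊃ B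
∧-elʳᴬ A B = interpreted (axiom (ax-∧-elʳ _ _) (τ-free (A ∧ᶠ B ⊃ B)))

∧-inᴬ : ∀ A B → ⊢ A ⊃ B ⊃ A ∧ᶠ B
∧-inᴬ A B = interpreted (axiom (ax-∧-in _ _) (τ-free (A ⊃ B ⊃ A ∧ᶠ B)))

⊥ᴬ : ∀ A → ⊢ ⊥ᶠ ⊃ A
⊥ᴬ A = interpreted (axiom (ax-⊥ _) (τ-free (⊥ᶠ ⊃ A)))

Kᴬ : ∀ A B → ⊢ □ (A ⊃ B) ⊃ □ A ⊃ □ B
Kᴬ A B = interpreted (axiom (ax-K _ _) (τ-free (□ (A ⊃ B) ⊃ □ A ⊃ □ B)))

Löbᴬ : ∀ A → ⊢ □ (□ A ⊃ A) ⊃ □ A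
Löbᴬ A = interpreted (axiom (ax-Löb _) (τ-free (□ (□ A ⊃ A) ⊃ □ A)))

-- Propositional completeness (Kalmár's method)

const : ⊢ A → ⊢ X ⊃ A
const a = weakᴬ _ _ · a

infixl 4 _⊛_
_⊛_ : ⊢ X ⊃ A ⊃ B → ⊢ X ⊃ A → ⊢ X ⊃ B
f ⊛ a = distᴬ _ _ _ · f · a

⊃-refl : ⊢ A ⊃ A
⊃-refl {A} = weakᴬ A (A ⊃ A) ⊛ weakᴬ A A

⊃-trans : ⊢ A ⊃ B → ⊢ B ⊃ C → ⊢ A ⊃ C
⊃-trans f g = const g ⊛ f

-- Łukasiewicz's derivation: weakening gives `¬ᶠ ¬ᶠ ¬ᶠ ¬ᶠ A ⊃ ¬ᶠ ¬ᶠ A` from `¬ᶠ ¬ᶠ A`, two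
-- contrapositions give `¬ᶠ ¬ᶠ A ⊃ A`, and the repeated hypothesis is contracted.
¬¬-elim : ⊢ ¬ᶠ ¬ᶠ A ⊃ A
¬¬-elim {A} =
  ⊃-trans (⊃-trans (weakᴬ _ (¬ᶠ ¬ᶠ ¬ᶠ ¬ᶠ A)) (contraᴬ _ _)) (contraᴬ _ _) ⊛ ⊃-refl

¬¬-intro : ⊢ A ⊃ ¬ᶠ ¬ᶠ A
¬¬-intro = contraᴬ _ _ · ¬¬-elim

ex-falso : ⊢ ¬ᶠ A ⊃ A ⊃ B
ex-falso {A} {B} = ⊃-trans (weakᴬ _ (¬ᶠ B)) (contraᴬ _ _)

¬⊥ : ⊢ ¬ᶠ ⊥ᶠ
¬⊥ = contraᴬ _ _ · ⊃-trans ¬¬-elim (⊥ᴬ (¬ᶠ (⊥ᶠ ⊃ ⊥ᶠ))) · ⊥ᴬ ⊥ᶠ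

compose : ⊢ X ⊃ A ⊃ B → ⊢ X ⊃ B ⊃ C → ⊢ X ⊃ A ⊃ C
compose f g = ⊃-trans (⊃-trans g (weakᴬ _ _)) (distᴬ _ _ _) ⊛ f

contrapose : ⊢ X ⊃ A ⊃ B → ⊢ X ⊃ ¬ᶠ B ⊃ ¬ᶠ A
contrapose f =
  ⊃-trans (compose (compose (const ¬¬-elim) f) (const ¬¬-intro)) (contraᴬ _ _)

consequentia-mirabilis : ⊢ X ⊃ ¬ᶠ A ⊃ A → ⊢ X ⊃ A
consequentia-mirabilis f = ⊃-trans (contrapose X⊃¬A⊃⊥ ⊛ const ¬⊥) ¬¬-elim
  where
  X⊃¬A⊃⊥ = ⊃-trans (const ex-falso) (distᴬ _ _ _) ⊛ f

curryᶠ : ⊢ A ∧ᶠ B ⊃ C → ⊢ A ⊃ B ⊃ C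
curryᶠ f = compose (∧-inᴬ _ _) (const f)

-- Under `X`, `¬ᶠ C` refutes `A` by the first case and so gives `C` by the second; a formula implied
-- by its own negation holds.
by-cases : ⊢ X ∧ᶠ A ⊃ C → ⊢ X ∧ᶠ ¬ᶠ A ⊃ C → ⊢ X ⊃ C
by-cases f g = consequentia-mirabilis (compose (contrapose (curryᶠ f)) (curryᶠ g))

infix  9 ¬ᵗ_
infixr 8 _∧ᵗ_
infixr 7 _⊃ᵗ_
infixr 7.5 _∨ᵗ_

-- Reified propositional schemes: truth tables run on these, while modal formulas enter as opaque
-- values of the variables.
data Term (n : ℕ) : Set where
  varᵗ : Fin n → Term n
  ⊥ᵗ   : Term n
  ¬ᵗ_  : Term n → Term n
  _∧ᵗ_ : Term n → Term n → Term n

pattern ⊤ᵗ = ¬ᵗ ⊥ᵗ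

_⊃ᵗ_ : Term n → Term n → Term n
t ⊃ᵗ u = ¬ᵗ (t ∧ᵗ ¬ᵗ u)

_∨ᵗ_ : Term n → Term n → Term n
t ∨ᵗ u = ¬ᵗ (¬ᵗ t ∧ᵗ ¬ᵗ u)

instantiate : Vec Formula n → Term n → Formula
instantiate ρ (varᵗ i) = lookup ρ i
instantiate ρ ⊥ᵗ       = ⊥ᶠ
instantiate ρ (¬ᵗ t)   = ¬ᶠ instantiate ρ t
instantiate ρ (t ∧ᵗ u) = instantiate ρ t ∧ᶠ instantiate ρ u

eval : Vec Bool n → Term n → Bool
eval v (varᵗ i) = lookup v i
eval v ⊥ᵗ       = false
eval v (¬ᵗ t)   = not (eval v t)
eval v (t ∧ᵗ u) = eval v t && eval v u

literal : Bool → Formula → Formula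
literal true  A = A
literal false A = ¬ᶠ A

-- The literals are added to the base `X` from the left, so that `literals-elim` can discharge them
-- by induction, with `X` growing in the recursive calls.
literals : Formula → Vec Bool n → Vec Formula n → Formula
literals X []      []      = X
literals X (b ∷ v) (A ∷ ρ) = literals (X ∧ᶠ literal b A) v ρ

literals-base : (v : Vec Bool n) (ρ : Vec Formula n) → ⊢ literals X v ρ ⊃ X
literals-base []      []      = ⊃-refl
literals-base (b ∷ v) (A ∷ ρ) = ⊃-trans (literals-base v ρ) (∧-elˡᴬ _ _)

literals-lookup : (v : Vec Bool n) (ρ : Vec Formula n) (i : Fin n) →
                  ⊢ literals X v ρ ⊃ literal (lookup v i) (lookup ρ i)
literals-lookup (b ∷ v) (A ∷ ρ) zero    = ⊃-trans (literals-base v ρ) (∧-elʳᴬ _ _)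
literals-lookup (b ∷ v) (A ∷ ρ) (suc i) = literals-lookup v ρ i

literal-¬ : ∀ b → ⊢ X ⊃ literal b A → ⊢ X ⊃ literal (not b) (¬ᶠ A)
literal-¬ true  f = ⊃-trans f ¬¬-intro
literal-¬ false f = f

literal-∧ : ∀ b c → ⊢ X ⊃ literal b A → ⊢ X ⊃ literal c B →
            ⊢ X ⊃ literal (b && c) (A ∧ᶠ B)
literal-∧ true  true  f g = ⊃-trans f (∧-inᴬ _ _) ⊛ g
literal-∧ true  false f g = contrapose (const (∧-elʳᴬ _ _)) ⊛ g
literal-∧ false c     f g = contrapose (const (∧-elˡᴬ _ _)) ⊛ f

literals-eval : (v : Vec Bool n) (ρ : Vec Formula n) (t : Term n) →
                ⊢ literals X v ρ ⊃ literal (eval v t) (instantiate ρ t)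
literals-eval v ρ (varᵗ i) = literals-lookup v ρ i
literals-eval v ρ ⊥ᵗ       = const ¬⊥
literals-eval v ρ (¬ᵗ t)   = literal-¬ (eval v t) (literals-eval v ρ t)
literals-eval v ρ (t ∧ᵗ u) =
  literal-∧ (eval v t) (eval v u) (literals-eval v ρ t) (literals-eval v ρ u)

literals-elim : (ρ : Vec Formula n) → (∀ v → ⊢ literals X v ρ ⊃ C) → ⊢ X ⊃ C
literals-elim []      f = f []
literals-elim (A ∷ ρ) f =
  by-cases (literals-elim ρ (f ∘ (true ∷_))) (literals-elim ρ (f ∘ (false ∷_)))

all-true : ∀ n → (Vec Bool n → Bool) → Bool
all-true zero    f = f []
all-true (suc n) f = all-true n (f ∘ (true ∷_)) && all-true n (f ∘ (false ∷_))

all-true-sound : ∀ n f → T (all-true n f) → (v : Vec Bool n) → T (f v)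
all-true-sound zero    f p []          = p
all-true-sound (suc n) f p (true ∷ v)  =
  all-true-sound n _ (proj₁ (Equivalence.to T-∧ p)) v
all-true-sound (suc n) f p (false ∷ v) =
  all-true-sound n _ (proj₂ (Equivalence.to (T-∧ {all-true n (f ∘ (true ∷_))}) p)) v

literal-true : ∀ b → T b → ⊢ X ⊃ literal b A → ⊢ X ⊃ A
literal-true true _ f = f

tautology : (t : Term n) → T (all-true n (λ v → eval v t)) →
            (ρ : Vec Formula n) → ⊢ instantiate ρ t
tautology {n} t valid ρ = literals-elim ρ true-case · ¬⊥
  where
  true-case : ∀ v → ⊢ literals (¬ᶠ ⊥ᶠ) v ρ ⊃ instantiate ρ t
  true-case v =
    literal-true (eval v t) (all-true-sound n _ valid v) (literals-eval v ρ t)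

close : ∀ n → N-ary n (Term n) (Term n) → Term n
close n f = f $ⁿ Vec.map varᵗ (allFin n)

∀ⁿ-intro : ∀ n {P : Vec Formula n → Set} → (∀ ρ → P ρ) → ∀ⁿ n (curryⁿ P)
∀ⁿ-intro zero    p = p []
∀ⁿ-intro (suc n) p = λ A → ∀ⁿ-intro n (p ∘ (A ∷_))

-- For a valid scheme the type of `valid` computes to the unit type, so Agda fills it in and checks
-- the truth table during type checking.
taut : ∀ n (f : N-ary n (Term n) (Term n))
       {valid : T (all-true n (λ v → eval v (close n f)))} →
       ∀ⁿ n (curryⁿ {n = n} λ ρ → ⊢ instantiate ρ (close n f))
taut n f {valid} = ∀ⁿ-intro n (tautology (close n f) valid)

-- Modal principles

□-mono : ⊢ A ⊃ B → ⊢ □ A ⊃ □ B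
□-mono f = Kᴬ _ _ · necessitate f

□-mono₂ : ⊢ A ⊃ B ⊃ C → ⊢ □ A ⊃ □ B ⊃ □ C
□-mono₂ f = ⊃-trans (□-mono f) (Kᴬ _ _)

-- The standard derivation of transitivity: Löb's axiom for `A ∧ᶠ □ A`, whose Löb hypothesis follows
-- from `A`.
□-4 : ⊢ □ A ⊃ □ □ A
□-4 {A} = ⊃-trans (⊃-trans (□-mono step) (Löbᴬ (A ∧ᶠ □ A))) (□-mono (∧-elʳᴬ _ _))
  where
  step : ⊢ A ⊃ □ (A ∧ᶠ □ A) ⊃ A ∧ᶠ □ A
  step = taut 3 (λ a p q → (p ⊃ᵗ q) ⊃ᵗ (a ⊃ᵗ p ⊃ᵗ a ∧ᵗ q)) _ _ _ · □-mono (∧-elˡᴬ _ _)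

□-mono-4 : ⊢ A ⊃ □ A ⊃ B → ⊢ □ A ⊃ □ B
□-mono-4 f = □-mono₂ f ⊛ □-4

□⊥⊃□ : ⊢ □ ⊥ᶠ ⊃ □ A
□⊥⊃□ = □-mono (⊥ᴬ _)

-- Both sides have the same image under `τ`, so a proof of the trivial implication can be read at
-- this type.
■-elim : ⊢ ■ A ⊃ ⟪■⟫ A
■-elim {A} = interpreted (proof (⊃-refl {⟪■⟫ A}))

■-intro : ⊢ ⟪■⟫ A ⊃ ■ A
■-intro {A} = interpreted (proof (⊃-refl {⟪■⟫ A}))

-- Made for `■r₁`: its empty ⇒-component supplies the second disjunct, covering terminal worlds.
□⊃■∨□⊥ : ⊢ □ A ⊃ ■ A ∨ □ ⊥ᶠ
□⊃■∨□⊥ =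
  taut 4 (λ a p q m → ((p ∧ᵗ ¬ᵗ q) ∨ᵗ (q ∧ᵗ a) ⊃ᵗ m) ⊃ᵗ (p ⊃ᵗ m ∨ᵗ q)) _ _ _ _ · ■-intro

■⊃□ : ⊢ ■ A ⊃ □ A
■⊃□ =
  taut 4 (λ a p q m → (m ⊃ᵗ (p ∧ᵗ ¬ᵗ q) ∨ᵗ (q ∧ᵗ a)) ⊃ᵗ (q ⊃ᵗ p) ⊃ᵗ (m ⊃ᵗ p)) _ _ _ _
    · ■-elim · □⊥⊃□

-- By transitivity each successor satisfies both `A` and `□ A`: the former gives `■ A` if it is
-- terminal, the latter if it is not.
□⊃□■ : ⊢ □ A ⊃ □ ■ A
□⊃□■ = □-mono-4 (
  taut 4 (λ a p q m → ((p ∧ᵗ ¬ᵗ q) ∨ᵗ (q ∧ᵗ a) ⊃ᵗ m) ⊃ᵗ (a ⊃ᵗ p ⊃ᵗ m)) _ _ _ _ · ■-intro)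

■⊃□■ : ⊢ ■ A ⊃ □ ■ A
■⊃□■ = ⊃-trans ■⊃□ □⊃□■

-- A successor satisfies `¬ᶠ A` and `□ ¬ᶠ A`. If terminal, `■ A` would mean `A` there; if not, `□ A`
-- would clash with `□ ¬ᶠ A`.
□¬⊃□¬■ : ⊢ □ ¬ᶠ A ⊃ □ ¬ᶠ ■ A
□¬⊃□¬■ = □-mono-4 (
  taut 5 (λ a p q m r → (m ⊃ᵗ (p ∧ᵗ ¬ᵗ q) ∨ᵗ (q ∧ᵗ a)) ⊃ᵗ (r ⊃ᵗ p ⊃ᵗ q) ⊃ᵗ
                        (¬ᵗ a ⊃ᵗ r ⊃ᵗ ¬ᵗ m)) _ _ _ _ _
    · ■-elim · □-mono₂ (taut 1 (λ a → ¬ᵗ a ⊃ᵗ a ⊃ᵗ ⊥ᵗ) _))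

-- Soundness of GR

⋀ : List Formula → Formula
⋀ []      = ¬ᶠ ⊥ᶠ
⋀ (A ∷ Γ) = A ∧ᶠ ⋀ Γ

-- Negating the succedent, instead of using a disjunction, lets both sides share the lemmas on `⋀`.
sequentᶠ : List Formula → List Formula → Formula
sequentᶠ Γ Δ = ¬ᶠ (⋀ Γ ∧ᶠ ⋀ (map ¬ᶠ_ Δ))

at : Arrow → Formula → Formula
at single A = A
at double A = □ A

⟦_⟧ˢ : Sequent → Formula
⟦ Γ ⟨ ≫ ⟩ Δ ⟧ˢ = at ≫ (sequentᶠ Γ Δ)

⟦_⟧ : Hypersequent → Formula
⟦ [] ⟧    = ⊥ᶠ
⟦ S ∣ H ⟧ = ⟦ S ⟧ˢ ∨ ⟦ H ⟧

at-mono : ∀ ≫ → ⊢ A ⊃ B → ⊢ at ≫ A ⊃ at ≫ B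
at-mono single f = f
at-mono double f = □-mono f

at-mono₂ : ∀ ≫ → ⊢ A ⊃ B ⊃ C → ⊢ at ≫ A ⊃ at ≫ B ⊃ at ≫ C
at-mono₂ single f = f
at-mono₂ double f = □-mono₂ f

⋀-++ : ∀ Γ → ⊢ ⋀ (Γ ++ Δ) ⊃ ⋀ Γ ∧ᶠ ⋀ Δ
⋀-++ []      = taut 1 (λ d → d ⊃ᵗ ⊤ᵗ ∧ᵗ d) _
⋀-++ (A ∷ Γ) =
  taut 4 (λ a g d x → (x ⊃ᵗ g ∧ᵗ d) ⊃ᵗ (a ∧ᵗ x ⊃ᵗ (a ∧ᵗ g) ∧ᵗ d)) _ _ _ _ · ⋀-++ Γ

⋀-++⁻ : ∀ Γ → ⊢ ⋀ Γ ∧ᶠ ⋀ Δ ⊃ ⋀ (Γ ++ Δ)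
⋀-++⁻ []      = taut 1 (λ d → ⊤ᵗ ∧ᵗ d ⊃ᵗ d) _
⋀-++⁻ (A ∷ Γ) =
  taut 4 (λ a g d x → (g ∧ᵗ d ⊃ᵗ x) ⊃ᵗ ((a ∧ᵗ g) ∧ᵗ d ⊃ᵗ a ∧ᵗ x)) _ _ _ _ · ⋀-++⁻ Γ

⋀-↭ : Γ ↭ Δ → ⊢ ⋀ Γ ⊃ ⋀ Δ
⋀-↭ refl         = ⊃-refl
⋀-↭ (prep A p)   = taut 3 (λ a g d → (g ⊃ᵗ d) ⊃ᵗ (a ∧ᵗ g ⊃ᵗ a ∧ᵗ d)) _ _ _ · ⋀-↭ p
⋀-↭ (swap A B p) =
  taut 4 (λ a b g d → (g ⊃ᵗ d) ⊃ᵗ (a ∧ᵗ b ∧ᵗ g ⊃ᵗ b ∧ᵗ a ∧ᵗ d)) _ _ _ _ · ⋀-↭ p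
⋀-↭ (trans p q)  = ⊃-trans (⋀-↭ p) (⋀-↭ q)

¬∧-antitone : ⊢ A ⊃ P → ⊢ B ⊃ Q → ⊢ ¬ᶠ (P ∧ᶠ Q) ⊃ ¬ᶠ (A ∧ᶠ B)
¬∧-antitone f g =
  taut 4 (λ a p b q → (a ⊃ᵗ p) ⊃ᵗ (b ⊃ᵗ q) ⊃ᵗ (¬ᵗ (p ∧ᵗ q) ⊃ᵗ ¬ᵗ (a ∧ᵗ b))) _ _ _ _ · f · g

-- Separates the four lists into independent conjuncts, so that a truth table can treat each as an
-- atom.
sequentᶠ-++ : ∀ Γ Δ →
  ⊢ ¬ᶠ ((⋀ Γ ∧ᶠ ⋀ Π) ∧ᶠ (⋀ (map ¬ᶠ_ Δ) ∧ᶠ ⋀ (map ¬ᶠ_ Θ))) ⊃ sequentᶠ (Γ ++ Π) (Δ ++ Θ)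
sequentᶠ-++ {Θ = Θ} Γ Δ = ¬∧-antitone (⋀-++ Γ)
  (subst (λ Ξ → ⊢ ⋀ Ξ ⊃ ⋀ (map ¬ᶠ_ Δ) ∧ᶠ ⋀ (map ¬ᶠ_ Θ)) (sym (map-++ ¬ᶠ_ Δ Θ))
         (⋀-++ (map ¬ᶠ_ Δ)))

sequentᶠ-++⁻ : ∀ Γ Δ →
  ⊢ sequentᶠ (Γ ++ Π) (Δ ++ Θ) ⊃ ¬ᶠ ((⋀ Γ ∧ᶠ ⋀ Π) ∧ᶠ (⋀ (map ¬ᶠ_ Δ) ∧ᶠ ⋀ (map ¬ᶠ_ Θ)))
sequentᶠ-++⁻ {Θ = Θ} Γ Δ = ¬∧-antitone (⋀-++⁻ Γ)
  (subst (λ Ξ → ⊢ ⋀ (map ¬ᶠ_ Δ) ∧ᶠ ⋀ (map ¬ᶠ_ Θ) ⊃ ⋀ Ξ) (sym (map-++ ¬ᶠ_ Δ Θ))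
         (⋀-++⁻ (map ¬ᶠ_ Δ)))

private
  variable
    S S′ : Sequent
    H I  : Hypersequent

≈ˢ-sound : S ≈ˢ S′ → ⊢ ⟦ S ⟧ˢ ⊃ ⟦ S′ ⟧ˢ
≈ˢ-sound (seq≈ ≫ p q) =
  at-mono ≫ (¬∧-antitone (⋀-↭ (↭-sym p)) (⋀-↭ (↭-sym (↭-map⁺ ¬ᶠ_ q))))

∨-mono : ⊢ A ⊃ P → ⊢ B ⊃ Q → ⊢ A ∨ B ⊃ P ∨ Q
∨-mono f g =
  taut 4 (λ a p b q → (a ⊃ᵗ p) ⊃ᵗ (b ⊃ᵗ q) ⊃ᵗ (a ∨ᵗ b ⊃ᵗ p ∨ᵗ q)) _ _ _ _ · f · g

pointwise-sound : Pointwise _≈ˢ_ H I → ⊢ ⟦ H ⟧ ⊃ ⟦ I ⟧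
pointwise-sound []       = ⊃-refl
pointwise-sound (e ∷ es) = ∨-mono (≈ˢ-sound e) (pointwise-sound es)

≈ᴴ-sound : H ≈ᴴ I → ⊢ ⟦ H ⟧ ⊃ ⟦ I ⟧
≈ᴴ-sound (refl es)     = pointwise-sound es
≈ᴴ-sound (prep e p)    = ∨-mono (≈ˢ-sound e) (≈ᴴ-sound p)
≈ᴴ-sound (swap e e′ p) =
  ⊃-trans (∨-mono (≈ˢ-sound e) (∨-mono (≈ˢ-sound e′) (≈ᴴ-sound p)))
          (taut 3 (λ a b c → (a ∨ᵗ b ∨ᵗ c) ⊃ᵗ (b ∨ᵗ a ∨ᵗ c)) _ _ _)
≈ᴴ-sound (trans p q)   = ⊃-trans (≈ᴴ-sound p) (≈ᴴ-sound q)

∨-++ : ∀ H → ⊢ ⟦ H ⟧ ∨ ⟦ I ⟧ ⊃ ⟦ H ++ I ⟧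
∨-++ []      = taut 1 (λ i → (⊥ᵗ ∨ᵗ i) ⊃ᵗ i) _
∨-++ (S ∣ H) =
  taut 4 (λ s h i x → (h ∨ᵗ i ⊃ᵗ x) ⊃ᵗ ((s ∨ᵗ h) ∨ᵗ i ⊃ᵗ s ∨ᵗ x)) _ _ _ _ · ∨-++ H

rule₁ : ⊢ P ⊃ Q → ⊢ P ∨ X → ⊢ Q ∨ X
rule₁ f d = ∨-mono f ⊃-refl · d

rule₂ : ⊢ P ⊃ Q ⊃ R → ⊢ P ∨ ⟦ H ⟧ → ⊢ Q ∨ ⟦ I ⟧ → ⊢ R ∨ ⟦ H ++ I ⟧
rule₂ {H = H} f d e =
  taut 6 (λ p q r h i x → (p ⊃ᵗ q ⊃ᵗ r) ⊃ᵗ (h ∨ᵗ i ⊃ᵗ x) ⊃ᵗ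
                          (p ∨ᵗ h) ⊃ᵗ (q ∨ᵗ i) ⊃ᵗ (r ∨ᵗ x)) _ _ _ _ _ _
    · f · ∨-++ H · d · e

-- The common shape of `K□`, `4□`, `K■` and `4■`: either `A` fails, making the new →-component true,
-- or `A` carries `P` to `Q`.
box-left-rule : ⊢ P ⊃ A ⊃ Q → ⊢ P ∨ X → ⊢ sequentᶠ [ A ] [] ∨ Q ∨ X
box-left-rule f d =
  taut 4 (λ p a q x → (p ⊃ᵗ a ⊃ᵗ q) ⊃ᵗ (p ∨ᵗ x) ⊃ᵗ
                      (¬ᵗ ((a ∧ᵗ ⊤ᵗ) ∧ᵗ ⊤ᵗ) ∨ᵗ q ∨ᵗ x)) _ _ _ _ · f · d

discharge : ⊢ sequentᶠ (A ∷ Γ) Δ ⊃ A ⊃ sequentᶠ Γ Δ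
discharge = taut 3 (λ a g d → ¬ᵗ ((a ∧ᵗ g) ∧ᵗ d) ⊃ᵗ a ⊃ᵗ ¬ᵗ (g ∧ᵗ d)) _ _ _

Löb-rule : ⊢ □ sequentᶠ [ □ A ] [ A ] ⊃ □ A
Löb-rule {A} =
  ⊃-trans (□-mono (taut 2 (λ a b → ¬ᵗ ((b ∧ᵗ ⊤ᵗ) ∧ᵗ ¬ᵗ a ∧ᵗ ⊤ᵗ) ⊃ᵗ b ⊃ᵗ a) A (□ A)))
          (Löbᴬ A)

-- Necessitation and its converse act on whole theorems, so the closing `⊥ᶠ` of the disjunction has
-- to be stripped first.
component : ⊢ ⟦ [ S ] ⟧ → ⊢ ⟦ S ⟧ˢ
component d = taut 1 (λ s → s ∨ᵗ ⊥ᵗ ⊃ᵗ s) _ · d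

component⁻ : ⊢ ⟦ S ⟧ˢ → ⊢ ⟦ [ S ] ⟧
component⁻ d = taut 1 (λ s → s ⊃ᵗ s ∨ᵗ ⊥ᵗ) _ · d

sound : GR⊢ʰ H → ⊢ ⟦ H ⟧
sound (exch p d) = ≈ᴴ-sound p · sound d
sound (init A)   = taut 1 (λ a → ¬ᵗ ((a ∧ᵗ ⊤ᵗ) ∧ᵗ ¬ᵗ a ∧ᵗ ⊤ᵗ) ∨ᵗ ⊥ᵗ) _
sound init⊥      = taut 0 (¬ᵗ ((⊥ᵗ ∧ᵗ ⊤ᵗ) ∧ᵗ ⊤ᵗ) ∨ᵗ ⊥ᵗ)
sound (∧l₁ {≫ = ≫} d) = rule₁ (at-mono ≫
  (taut 4 (λ a b g d → ¬ᵗ ((a ∧ᵗ g) ∧ᵗ d) ⊃ᵗ ¬ᵗ (((a ∧ᵗ b) ∧ᵗ g) ∧ᵗ d)) _ _ _ _)) (sound d)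
sound (∧l₂ {≫ = ≫} d) = rule₁ (at-mono ≫
  (taut 4 (λ a b g d → ¬ᵗ ((b ∧ᵗ g) ∧ᵗ d) ⊃ᵗ ¬ᵗ (((a ∧ᵗ b) ∧ᵗ g) ∧ᵗ d)) _ _ _ _)) (sound d)
sound (∧r {Γ = Γ} {≫ = ≫} {A = A} {Δ = Δ} {B = B} d e) = rule₂ (at-mono₂ ≫
  (taut 7 (λ a b g p d t x →
      (¬ᵗ ((g ∧ᵗ p) ∧ᵗ (¬ᵗ (a ∧ᵗ b) ∧ᵗ d) ∧ᵗ t) ⊃ᵗ x) ⊃ᵗ
      ¬ᵗ (g ∧ᵗ ¬ᵗ a ∧ᵗ d) ⊃ᵗ ¬ᵗ (p ∧ᵗ ¬ᵗ b ∧ᵗ t) ⊃ᵗ x) _ _ _ _ _ _ _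
    · sequentᶠ-++ Γ (A ∧ᶠ B ∷ Δ))) (sound d) (sound e)
sound (¬l {≫ = ≫} d) = rule₁ (at-mono ≫
  (taut 3 (λ a g d → ¬ᵗ (g ∧ᵗ ¬ᵗ a ∧ᵗ d) ⊃ᵗ ¬ᵗ ((¬ᵗ a ∧ᵗ g) ∧ᵗ d)) _ _ _)) (sound d)
sound (¬r {≫ = ≫} d) = rule₁ (at-mono ≫
  (taut 3 (λ a g d → ¬ᵗ ((a ∧ᵗ g) ∧ᵗ d) ⊃ᵗ ¬ᵗ (g ∧ᵗ ¬ᵗ ¬ᵗ a ∧ᵗ d)) _ _ _)) (sound d)
sound (icl {≫ = ≫} d) = rule₁ (at-mono ≫
  (taut 3 (λ a g d → ¬ᵗ ((a ∧ᵗ a ∧ᵗ g) ∧ᵗ d) ⊃ᵗ ¬ᵗ ((a ∧ᵗ g) ∧ᵗ d)) _ _ _)) (sound d)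
sound (icr {≫ = ≫} d) = rule₁ (at-mono ≫
  (taut 3 (λ a g d → ¬ᵗ (g ∧ᵗ ¬ᵗ a ∧ᵗ ¬ᵗ a ∧ᵗ d) ⊃ᵗ ¬ᵗ (g ∧ᵗ ¬ᵗ a ∧ᵗ d)) _ _ _)) (sound d)
sound (iwl {≫ = ≫} d) = rule₁ (at-mono ≫
  (taut 3 (λ a g d → ¬ᵗ (g ∧ᵗ d) ⊃ᵗ ¬ᵗ ((a ∧ᵗ g) ∧ᵗ d)) _ _ _)) (sound d)
sound (iwr {≫ = ≫} d) = rule₁ (at-mono ≫
  (taut 3 (λ a g d → ¬ᵗ (g ∧ᵗ d) ⊃ᵗ ¬ᵗ (g ∧ᵗ ¬ᵗ a ∧ᵗ d)) _ _ _)) (sound d)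
sound (cut {Γ = Γ} {≫ = ≫} {Δ = Δ} d e) = rule₂ (at-mono₂ ≫
  (taut 6 (λ a g p d t x →
      (¬ᵗ ((g ∧ᵗ p) ∧ᵗ d ∧ᵗ t) ⊃ᵗ x) ⊃ᵗ
      ¬ᵗ (g ∧ᵗ ¬ᵗ a ∧ᵗ d) ⊃ᵗ ¬ᵗ ((a ∧ᵗ p) ∧ᵗ t) ⊃ᵗ x) _ _ _ _ _ _
    · sequentᶠ-++ Γ Δ)) (sound d) (sound e)
sound (ew d) = taut 2 (λ s h → h ⊃ᵗ s ∨ᵗ h) _ _ · sound d
-- Classically, a conjunction implying a disjunction splits into a disjunction of implications; no
-- `□` intervenes for →-sequents.
sound (split {Γ = Γ} {Δ = Δ} d) =
  taut 6 (λ g p d t x h →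
      (x ⊃ᵗ ¬ᵗ ((g ∧ᵗ p) ∧ᵗ d ∧ᵗ t)) ⊃ᵗ (x ∨ᵗ h) ⊃ᵗ
      (¬ᵗ (g ∧ᵗ d) ∨ᵗ ¬ᵗ (p ∧ᵗ t) ∨ᵗ h)) _ _ _ _ _ _
    · sequentᶠ-++⁻ Γ Δ · sound d
-- Each of the two components alone implies the merged one by weakening, also under `□`.
sound (merge {Γ = Γ} {≫ = ≫} {Δ = Δ} d) =
  taut 4 (λ p q r h → (p ⊃ᵗ r) ⊃ᵗ (q ⊃ᵗ r) ⊃ᵗ (p ∨ᵗ q ∨ᵗ h) ⊃ᵗ (r ∨ᵗ h)) _ _ _ _
    · at-mono ≫ (⊃-trans
        (taut 4 (λ g p d t → ¬ᵗ (g ∧ᵗ d) ⊃ᵗ ¬ᵗ ((g ∧ᵗ p) ∧ᵗ d ∧ᵗ t)) _ _ _ _)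
        (sequentᶠ-++ Γ Δ))
    · at-mono ≫ (⊃-trans
        (taut 4 (λ g p d t → ¬ᵗ (p ∧ᵗ t) ⊃ᵗ ¬ᵗ ((g ∧ᵗ p) ∧ᵗ d ∧ᵗ t)) _ _ _ _)
        (sequentᶠ-++ Γ Δ))
    · sound d
sound (drop⟶ d) =
  taut 2 (λ s h → (s ∨ᵗ ¬ᵗ (⊤ᵗ ∧ᵗ ⊤ᵗ) ∨ᵗ h) ⊃ᵗ (s ∨ᵗ h)) _ _ · sound d
sound (K□ d) = box-left-rule (□-mono₂ discharge) (sound d)
sound (4□ d) = box-left-rule (compose (const □-4) (□-mono₂ discharge)) (sound d)
sound (□r d) = rule₁ (⊃-trans Löb-rule
  (taut 1 (λ a → a ⊃ᵗ ¬ᵗ (⊤ᵗ ∧ᵗ ¬ᵗ a ∧ᵗ ⊤ᵗ)) _)) (sound d)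
sound (K■ d) = box-left-rule (compose (const ■⊃□) (□-mono₂ discharge)) (sound d)
sound (4■ d) = box-left-rule (compose (const ■⊃□■) (□-mono₂ discharge)) (sound d)
sound (■r₁ d) =
  taut 5 (λ p m q r h →
      (p ⊃ᵗ m ∨ᵗ q) ⊃ᵗ (q ⊃ᵗ r) ⊃ᵗ (p ∨ᵗ h) ⊃ᵗ
      (¬ᵗ (⊤ᵗ ∧ᵗ ¬ᵗ m ∧ᵗ ⊤ᵗ) ∨ᵗ r ∨ᵗ h)) _ _ _ _ _
    · ⊃-trans Löb-rule □⊃■∨□⊥ · □⊥⊃□ · sound d
sound (■l d) = rule₁ (⊃-trans
  (□-mono (taut 1 (λ a → ¬ᵗ ((a ∧ᵗ ⊤ᵗ) ∧ᵗ ⊤ᵗ) ⊃ᵗ ¬ᵗ a) _)) (⊃-trans □¬⊃□¬■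
  (□-mono (taut 1 (λ a → ¬ᵗ a ⊃ᵗ ¬ᵗ ((a ∧ᵗ ⊤ᵗ) ∧ᵗ ⊤ᵗ)) _)))) (sound d)
sound (■r₂ d) = rule₁ (⊃-trans
  (□-mono (taut 1 (λ a → ¬ᵗ (⊤ᵗ ∧ᵗ ¬ᵗ a ∧ᵗ ⊤ᵗ) ⊃ᵗ a) _)) (⊃-trans □⊃□■
  (□-mono (taut 1 (λ a → a ⊃ᵗ ¬ᵗ (⊤ᵗ ∧ᵗ ¬ᵗ a ∧ᵗ ⊤ᵗ)) _)))) (sound d)
sound (to⟹ d) = component⁻ (necessitate (component (sound d)))
sound (to⟶ d) = component⁻ (denecessitate (component (sound d)))

GR⇒GL : ■-Free A → GR⊢ A → GL⊢ A
GR⇒GL free d = subst GL⊢_ (τ-id free) (proof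
  (taut 1 (λ a → ¬ᵗ (⊤ᵗ ∧ᵗ ¬ᵗ a ∧ᵗ ⊤ᵗ) ⊃ᵗ a) _ · component (sound d)))

-- Completeness of GR for GL

≈ˢ-refl : S ≈ˢ S
≈ˢ-refl = seq≈ _ refl refl

≈ᴴ-refl : H ≈ᴴ H
≈ᴴ-refl = refl (Pointwise.refl ≈ˢ-refl)

permute : Γ ↭ Π → Δ ↭ Θ → GR⊢ʰ [ Γ ⟶ Δ ] → GR⊢ʰ [ Π ⟶ Θ ]
permute p q = exch (prep (seq≈ _ p q) ≈ᴴ-refl)

swap-components : GR⊢ʰ S ∣ S′ ∣ H → GR⊢ʰ S′ ∣ S ∣ H
swap-components = exch (swap ≈ˢ-refl ≈ˢ-refl ≈ᴴ-refl)

-- Contraction against any occurrence turns the rules below into context-sharing ones that keep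
-- their principal formula.
contractˡ : A ∈ Γ → GR⊢ʰ [ A ∷ Γ ⟶ Δ ] → GR⊢ʰ [ Γ ⟶ Δ ]
contractˡ {A} A∈Γ d with ys , zs , refl ← ∈-∃++ A∈Γ =
  permute (↭-sym (shift A ys zs)) refl (icl (permute (prep A (shift A ys zs)) refl d))

contractʳ : A ∈ Δ → GR⊢ʰ [ Γ ⟶ A ∷ Δ ] → GR⊢ʰ [ Γ ⟶ Δ ]
contractʳ {A} A∈Δ d with ys , zs , refl ← ∈-∃++ A∈Δ =
  permute refl (↭-sym (shift A ys zs)) (icr (permute refl (prep A (shift A ys zs)) d))

contractˡ* : ∀ Σ → (∀ {A} → A ∈ Σ → A ∈ Γ) → GR⊢ʰ [ Σ ++ Γ ⟶ Δ ] → GR⊢ʰ [ Γ ⟶ Δ ]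
contractˡ* []      Σ⊆Γ d = d
contractˡ* (A ∷ Σ) Σ⊆Γ d =
  contractˡ* Σ (Σ⊆Γ ∘ there) (contractˡ (∈-++⁺ʳ Σ (Σ⊆Γ (here refl))) d)

contractʳ* : ∀ Σ → (∀ {A} → A ∈ Σ → A ∈ Δ) → GR⊢ʰ [ Γ ⟶ Σ ++ Δ ] → GR⊢ʰ [ Γ ⟶ Δ ]
contractʳ* []      Σ⊆Δ d = d
contractʳ* (A ∷ Σ) Σ⊆Δ d =
  contractʳ* Σ (Σ⊆Δ ∘ there) (contractʳ (∈-++⁺ʳ Σ (Σ⊆Δ (here refl))) d)

weakenˡ : ∀ Σ → GR⊢ʰ [ Γ ⟶ Δ ] → GR⊢ʰ [ Σ ++ Γ ⟶ Δ ]
weakenˡ []      d = d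
weakenˡ (A ∷ Σ) d = iwl (weakenˡ Σ d)

weakenʳ : ∀ Σ → GR⊢ʰ [ Γ ⟶ Δ ] → GR⊢ʰ [ Γ ⟶ Σ ++ Δ ]
weakenʳ []      d = d
weakenʳ (A ∷ Σ) d = iwr (weakenʳ Σ d)

identity : A ∈ Γ → A ∈ Δ → GR⊢ʰ [ Γ ⟶ Δ ]
identity {A} {Γ} {Δ} A∈Γ A∈Δ = contractˡ A∈Γ (contractʳ A∈Δ
  (permute (++-comm Γ [ A ]) (++-comm Δ [ A ]) (weakenˡ Γ (weakenʳ Δ (init A)))))

∧-right : GR⊢ʰ [ Γ ⟶ A ∷ Δ ] → GR⊢ʰ [ Γ ⟶ B ∷ Δ ] → GR⊢ʰ [ Γ ⟶ A ∧ᶠ B ∷ Δ ]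
∧-right {Γ} {A} {Δ} {B} d e =
  contractˡ* Γ id (contractʳ* Δ there (permute refl (↭-sym (shift (A ∧ᶠ B) Δ Δ)) (∧r d e)))

¬-left : ¬ᶠ A ∈ Γ → GR⊢ʰ [ Γ ⟶ A ∷ Δ ] → GR⊢ʰ [ Γ ⟶ Δ ]
¬-left m d = contractˡ m (¬l d)

⊃-right : GR⊢ʰ [ A ∷ Γ ⟶ B ∷ Δ ] → GR⊢ʰ [ Γ ⟶ A ⊃ B ∷ Δ ]
-- Both `A` and `¬ᶠ B` are absorbed into copies of `A ∧ᶠ ¬ᶠ B`, which are then contracted.
⊃-right d = ¬r (icl (∧l₁ (permute (swap _ _ refl) refl (∧l₂ (¬l d)))))

⊃-left : A ⊃ B ∈ Γ → GR⊢ʰ [ Γ ⟶ A ∷ Δ ] → GR⊢ʰ [ B ∷ Γ ⟶ Δ ] → GR⊢ʰ [ Γ ⟶ Δ ]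
⊃-left m d e = ¬-left m (∧-right d (¬r e))

pattern 0ᵗʰ = here refl
pattern 1ˢᵗ = there 0ᵗʰ
pattern 2ⁿᵈ = there 1ˢᵗ

-- Read upwards: `merge` isolates each boxed formula, `□r` opens a ⇒-component, and `K□` moves the
-- unboxed antecedents into it, leaving a propositional sequent.
GR-K : GR⊢ □ (A ⊃ B) ⊃ □ A ⊃ □ B
GR-K =
  ⊃-right (⊃-right (merge (merge (□r (iwl (swap-components (K□ (swap-components (K□
    (to⟹ (⊃-left 0ᵗʰ (identity 1ˢᵗ 0ᵗʰ) (identity 0ᵗʰ 0ᵗʰ))))))))))))

-- The diagonal formula `□ A` introduced by `□r`, read upwards, is what the unboxed `□ A ⊃ A` needs
-- to yield `A`.
GR-Löb : GR⊢ □ (□ A ⊃ A) ⊃ □ A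
GR-Löb =
  ⊃-right (merge (□r (swap-components (K□
    (to⟹ (⊃-left 0ᵗʰ (identity 1ˢᵗ 0ᵗʰ) (identity 0ᵗʰ 0ᵗʰ)))))))

GR-axiom : GLAxiom A → GR⊢ A
GR-axiom (ax-weak A B)   = ⊃-right (⊃-right (identity 1ˢᵗ 0ᵗʰ))
GR-axiom (ax-dist A B C) = ⊃-right (⊃-right (⊃-right
  (⊃-left 2ⁿᵈ (identity 0ᵗʰ 0ᵗʰ) (⊃-left 0ᵗʰ
    (⊃-left 2ⁿᵈ (identity 1ˢᵗ 0ᵗʰ) (identity 0ᵗʰ 0ᵗʰ)) (identity 0ᵗʰ 0ᵗʰ)))))
GR-axiom (ax-contra A B) = ⊃-right (⊃-right
  (⊃-left 1ˢᵗ (¬r (identity 0ᵗʰ 0ᵗʰ)) (¬-left 0ᵗʰ (identity 1ˢᵗ 0ᵗʰ))))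
GR-axiom (ax-∧-elˡ A B)  = ⊃-right (∧l₁ (init A))
GR-axiom (ax-∧-elʳ A B)  = ⊃-right (∧l₂ (init B))
GR-axiom (ax-∧-in A B)   =
  ⊃-right (⊃-right (∧-right (identity 1ˢᵗ 0ᵗʰ) (identity 0ᵗʰ 0ᵗʰ)))
GR-axiom (ax-⊥ A)        = ⊃-right (iwr init⊥)
GR-axiom (ax-K A B)      = GR-K
GR-axiom (ax-Löb A)      = GR-Löb

GL⇒GR : GL⊢ A → GR⊢ A
GL⇒GR (axiom a _) = GR-axiom a
GL⇒GR (mp d e)    = cut (GL⇒GR e)
  (⊃-left 0ᵗʰ (iwl (permute refl (swap _ _ refl) (iwr (GL⇒GR d)))) (identity 0ᵗʰ 0ᵗʰ))
GL⇒GR (nec d)     = □r (iwl (to⟹ (GL⇒GR d)))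

corollary3p8 : ∀ (A : Formula) → ■-Free A → (GR⊢ A) ⇔ (GL⊢ A)
corollary3p8 A free = mk⇔ (GR⇒GL free) GL⇒GR
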